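{- Let $d$, $n$, $a$ be positive integers with $1 \leq a \leq d+1$. Then $$h_d^{(a)}(n)=f_d^{(a)}(n).$$ Moreover, for every positive integer $\lambda$, the number of partitions counted by $h_d^{(a)}(n)$ with exactly $\lambda$ parts equals the number of partitions counted by $f_d^{(a)}(n)$ with largest part $a+(d+1)(\lambda-1)$; namely, for all positive integers $\alpha,\lambda$ (with $n=\alpha+\lambda-1$), $$h_d^{(a)}(\alpha, \lambda)=f_d^{(a)}\bigl(a+(d+1)(\lambda-1),\ \alpha-a-d(\lambda-1)+1\bigr).$$
   Context: A partition $\pi$ is a finite nonempty nonincreasing sequence of positive integers, called its parts. Its perimeter is (largest part of $\pi$) $+$ (number of parts of $\pi$) $-\,1$. A partition is $d$-distinct if any two consecutive parts $\pi_i\ge \pi_{i+1}$ satisfy $\pi_i-\pi_{i+1}\geq d$. For positive integers $n,a,d$: - $h_d^{(a)}(n)$ is the number of partitions with perimeter $n$ whose parts are $d$-distinct and all $\geq a$; - $f_d^{(a)}(n)$ is the number of partitions with perimeter $n$ whose parts are all $\equiv a \pmod{d+1}$. For integers $\alpha,\lambda$: - $h_d^{(a)}(\alpha,\lambda)$ is the number of partitions with largest part $\alpha$ and exactly $\lambda$ parts (hence perimeter $\alpha+\lambda-1$) whose parts are $d$-distinct and all $\geq a$; - $f_d^{(a)}(\alpha,\lambda)$ is the number of partitions with largest part $\alpha$ and exactly $\lambda$ parts (hence perimeter $\alpha+\lambda-1$) whose parts are all $\equiv a \pmod{d+1}$. In particular these counts are $0$ when no such partition exists (e.g. when $\lambda\le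 0$). -}

module Defs where

open import Data.Integer.Base as ℤ using (ℤ; +_; ∣_∣)
import Data.Integer.Divisibility as ℤ
import Data.Integer.Properties as ℤ
open import Data.List.Base as List using (List; []; _∷_; upTo; filter; cartesianProductWith)
open import Data.List.Membership.Propositional using (_∈_)
open import Data.List.Membership.Propositional.Properties
  using (∈-upTo⁺; ∈-cartesianProductWith⁺; ∈-cartesianProductWith⁻; ∈-filter⁺; ∈-filter⁻)
open import Data.List.NonEmpty.Base as List⁺ using (List⁺; _∷_; toList; foldr₁)
open import Data.List.Relation.Unary.All as All using (All; []; _∷_)
open import Data.List.Relation.Unary.Any using (here; there)
open import Data.List.Relation.Unary.AllPairs using ([]; _∷_)
open import Data.List.Relation.Unary.Linked using (Linked; linked?)
open import Data.List.Relation.Unary.Unique.Propositional using (Unique)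
import Data.List.Relation.Unary.Unique.Propositional.Properties as Unique
open import Data.Nat.Base using (ℕ; zero; suc; _+_; _∸_; _≤_; _≥_; _⊔_; z≤n; s≤s)
open import Data.Nat.Divisibility using (_∣?_)
open import Data.Nat.Properties
open import Data.Product.Base using (_×_; _,_; proj₁; proj₂)
open import Level using (0ℓ)
open import Relation.Binary.PropositionalEquality using (_≡_; _≢_; refl; sym; subst)
open import Relation.Nullary.Decidable using (_×-dec_)
open import Relation.Unary using (Pred; Decidable)

------------------------------------------------------------------------
-- Partitions

IsPartition : Pred (List⁺ ℕ) 0ℓ
IsPartition π = Linked _≥_ (toList π) × All (1 ≤_) (toList π)

largest : List⁺ ℕ → ℕ
largest = foldr₁ _⊔_

#parts : List⁺ ℕ → ℕ
#parts = List⁺.length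

-- The truncated subtraction is exact: #parts π ≥ 1.
perimeter : List⁺ ℕ → ℕ
perimeter π = largest π + #parts π ∸ 1

-- y + d ≤ x states x - y ≥ d without truncated subtraction.
Distinct : ℕ → Pred (List⁺ ℕ) 0ℓ
Distinct d π = Linked (λ x y → y + d ≤ x) (toList π)

_≡_[mod_] : ℕ → ℕ → ℕ → Set
x ≡ a [mod m ] = + m ℤ.∣ (+ x ℤ.- + a)

HPartition : (d a : ℕ) → Pred (List⁺ ℕ) 0ℓ
HPartition d a π = IsPartition π × Distinct d π × All (a ≤_) (toList π)

FPartition : (d a : ℕ) → Pred (List⁺ ℕ) 0ℓ
FPartition d a π = IsPartition π × All (_≡ a [mod suc d ]) (toList π)

------------------------------------------------------------------------
-- Counting

-- A duplicate-free list of exactly the elements satisfying P.  Its length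
-- depends only on P.
record Enumeration {A : Set} (P : Pred A 0ℓ) : Set where
  field
    elements : List A
    unique   : Unique elements
    sound    : ∀ {x} → x ∈ elements → P x
    complete : ∀ {x} → P x → x ∈ elements

count : {A : Set} {P : Pred A 0ℓ} → Enumeration P → ℕ
count e = List.length (Enumeration.elements e)

private
  ∷-inj : ∀ {x y : ℕ} {xs ys : List ℕ} → x List.∷ xs ≡ y ∷ ys → x ≡ y × xs ≡ ys
  ∷-inj refl = refl , refl

  ∷⁺-inj : ∀ {x y : ℕ} {xs ys : List ℕ} → x List⁺.∷ xs ≡ y ∷ ys → x ≡ y × xs ≡ ys
  ∷⁺-inj refl = refl , refl

  -- Lists of length at most l with entries at most m.
  lists : (m l : ℕ) → List (List ℕ)
  lists m zero    = [] ∷ []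
  lists m (suc l) = [] ∷ cartesianProductWith _∷_ (upTo (suc m)) (lists m l)

  lists-unique : ∀ m l → Unique (lists m l)
  lists-unique m zero    = [] ∷ []
  lists-unique m (suc l) =
    All.tabulate []≢ ∷
    Unique.cartesianProductWith⁺ _∷_ ∷-inj (Unique.upTo⁺ (suc m)) (lists-unique m l)
    where
    []≢ : ∀ {xs} → xs ∈ cartesianProductWith _∷_ (upTo (suc m)) (lists m l) → [] ≢ xs
    []≢ xs∈ refl with ∈-cartesianProductWith⁻ _∷_ (upTo (suc m)) (lists m l) xs∈
    ... | _ , _ , _ , _ , ()

  lists-complete : ∀ {m} l {xs} → All (_≤ m) xs → List.length xs ≤ l → xs ∈ lists m l
  lists-complete zero    []         _         = here refl
  lists-complete (suc l) []         _         = here refl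
  lists-complete (suc l) (x≤ ∷ xs≤) (s≤s len) =
    there (∈-cartesianProductWith⁺ _∷_ (∈-upTo⁺ (s≤s x≤)) (lists-complete l xs≤ len))

  lists⁺ : (m l : ℕ) → List (List⁺ ℕ)
  lists⁺ m l = cartesianProductWith _∷_ (upTo (suc m)) (lists m l)

  parts≤largest : ∀ {m} x xs → largest (x ∷ xs) ≤ m → All (_≤ m) (x ∷ xs)
  parts≤largest x []       x≤ = x≤ ∷ []
  parts≤largest x (y ∷ ys) ≤m =
    m⊔n≤o⇒m≤o x _ ≤m ∷ parts≤largest y ys (m⊔n≤o⇒n≤o x _ ≤m)

  lists⁺-complete : ∀ {m l} π → largest π ≤ m → #parts π ≤ l → π ∈ lists⁺ m l
  lists⁺-complete {l = l} (x ∷ xs) ≤m len with parts≤largest x xs ≤m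
  ... | x≤ ∷ xs≤ = ∈-cartesianProductWith⁺ _∷_ (∈-upTo⁺ (s≤s x≤))
                     (lists-complete l xs≤ (≤-trans (n≤1+n _) len))

  largest≤perimeter : ∀ π → largest π ≤ perimeter π
  largest≤perimeter (x ∷ xs) rewrite +-suc (largest (x ∷ xs)) (List.length xs) = m≤m+n _ _

  1≤largest : ∀ π → IsPartition π → 1 ≤ largest π
  1≤largest (x ∷ [])     (_ , 1≤x ∷ _) = 1≤x
  1≤largest (x ∷ y ∷ ys) (_ , 1≤x ∷ _) = ≤-trans 1≤x (m≤m⊔n x _)

  #parts≤perimeter : ∀ π → IsPartition π → #parts π ≤ perimeter π
  #parts≤perimeter π@(x ∷ xs) p
    rewrite +-suc (largest π) (List.length xs) = +-monoˡ-≤ (List.length xs) (1≤largest π p)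

enumerate : {P : Pred (List⁺ ℕ) 0ℓ} → Decidable P → (m l : ℕ) →
            (∀ {π} → P π → largest π ≤ m × #parts π ≤ l) → Enumeration P
enumerate P? m l bound = record
  { elements = filter P? (lists⁺ m l)
  ; unique   = Unique.filter⁺ P?
                 (Unique.cartesianProductWith⁺ _∷_ ∷⁺-inj (Unique.upTo⁺ (suc m)) (lists-unique m l))
  ; sound    = λ x∈ → proj₂ (∈-filter⁻ P? {xs = lists⁺ m l} x∈)
  ; complete = λ {π} Pπ → ∈-filter⁺ P?
                 (lists⁺-complete π (proj₁ (bound Pπ)) (proj₂ (bound Pπ))) Pπ
  }

isPartition? : Decidable IsPartition
isPartition? π = linked? _≥?_ (toList π) ×-dec All.all? (1 ≤?_) (toList π)

hPartition? : ∀ d a → Decidable (HPartition d a)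
hPartition? d a π = isPartition? π ×-dec
  linked? (λ x y → y + d ≤? x) (toList π) ×-dec All.all? (a ≤?_) (toList π)

fPartition? : ∀ d a → Decidable (FPartition d a)
fPartition? d a π = isPartition? π ×-dec
  All.all? (λ x → suc d ∣? ∣ + x ℤ.- + a ∣) (toList π)

private
  perimeter-bound : ∀ {n} π → IsPartition π → perimeter π ≡ n → largest π ≤ n × #parts π ≤ n
  perimeter-bound π p refl = largest≤perimeter π , #parts≤perimeter π p

  shape-bound : ∀ {α ℓ} π → + largest π ≡ α → + #parts π ≡ ℓ →
                largest π ≤ ∣ α ∣ × #parts π ≤ ∣ ℓ ∣
  shape-bound π refl refl = ≤-refl , ≤-refl

hPartitions : ∀ d a n → Enumeration (λ π → HPartition d a π × perimeter π ≡ n)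
hPartitions d a n = enumerate (λ π → hPartition? d a π ×-dec perimeter π ≟ n) n n
  λ {π} (h , e) → perimeter-bound π (proj₁ h) e

fPartitions : ∀ d a n → Enumeration (λ π → FPartition d a π × perimeter π ≡ n)
fPartitions d a n = enumerate (λ π → fPartition? d a π ×-dec perimeter π ≟ n) n n
  λ {π} (f , e) → perimeter-bound π (proj₁ f) e

hPartitionsWithParts : ∀ d a n ℓ →
  Enumeration (λ π → (HPartition d a π × perimeter π ≡ n) × #parts π ≡ ℓ)
hPartitionsWithParts d a n ℓ =
  enumerate (λ π → (hPartition? d a π ×-dec perimeter π ≟ n) ×-dec #parts π ≟ ℓ) n n
  λ {π} ((h , e) , _) → perimeter-bound π (proj₁ h) e

fPartitionsWithLargest : ∀ d a n m →
  Enumeration (λ π → (FPartition d a π × perimeter π ≡ n) × largest π ≡ m)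
fPartitionsWithLargest d a n m =
  enumerate (λ π → (fPartition? d a π ×-dec perimeter π ≟ n) ×-dec largest π ≟ m) n n
  λ {π} ((f , e) , _) → perimeter-bound π (proj₁ f) e

hPartitionsOfShape : ∀ d a (α ℓ : ℤ) →
  Enumeration (λ π → HPartition d a π × + largest π ≡ α × + #parts π ≡ ℓ)
hPartitionsOfShape d a α ℓ =
  enumerate (λ π → hPartition? d a π ×-dec + largest π ℤ.≟ α ×-dec + #parts π ℤ.≟ ℓ)
    ∣ α ∣ ∣ ℓ ∣ λ {π} (_ , e₁ , e₂) → shape-bound π e₁ e₂

fPartitionsOfShape : ∀ d a (α ℓ : ℤ) →
  Enumeration (λ π → FPartition d a π × + largest π ≡ α × + #parts π ≡ ℓ)
fPartitionsOfShape d a α ℓ =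
  enumerate (λ π → fPartition? d a π ×-dec + largest π ℤ.≟ α ×-dec + #parts π ℤ.≟ ℓ)
    ∣ α ∣ ∣ ℓ ∣ λ {π} (_ , e₁ , e₂) → shape-bound π e₁ e₂

h f : (d a n : ℕ) → ℕ
h d a n = count (hPartitions d a n)
f d a n = count (fPartitions d a n)

h-shape f-shape : (d a : ℕ) (α ℓ : ℤ) → ℕ
h-shape d a α ℓ = count (hPartitionsOfShape d a α ℓ)
f-shape d a α ℓ = count (fPartitionsOfShape d a α ℓ)

{-# OPTIONS --safe #-}
-- Both families are generated from the one-part partition (a) by two moves on
-- the largest part x: on the h-side, replace x by x + 1, or prepend x + d; on
-- the f-side, prepend a copy of x, or replace x by x + (d + 1).  Every
-- partition of either family comes from exactly one word in its two moves.
-- The first moves raise the perimeter by 1 and the second ones by d + 1, so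
-- exchanging the moves is a perimeter-preserving bijection.  The number of
-- second moves is #parts - 1 on the h-side and (largest - a) / (d + 1) on the
-- f-side.
module Submission where

open import Defs
open import Data.Bool.Base using (Bool; true; false; not)
open import Data.Bool.Properties using (not-injective; not-involutive)
open import Data.Integer.Base as ℤ using (+_; ∣_∣)
import Data.Integer.Properties as ℤ
import Data.Integer.Tactic.RingSolver as ℤ-Ring
open import Data.List.Base using (List; []; _∷_; _++_; map; replicate; length)
open import Data.List.Membership.Propositional using (_∈_)
open import Data.List.Membership.Propositional.Properties using (∈-map⁺; ∈-map⁻)
open import Data.List.Membership.Propositional.Properties.WithK using (unique∧set⇒bag)
open import Data.List.NonEmpty.Base as List⁺ using (List⁺; _∷_)
open import Data.List.Properties using (length-map; map-injective; map-∘; map-cong; map-id)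
open import Data.List.Relation.Binary.BagAndSetEquality using (∼bag⇒↭)
open import Data.List.Relation.Binary.Permutation.Propositional.Properties using (↭-length)
open import Data.List.Relation.Unary.All as All using (All; []; _∷_)
open import Data.List.Relation.Unary.Any using (here; there)
open import Data.List.Relation.Unary.Linked as Linked using (Linked; [-]; _∷_)
open import Data.List.Relation.Unary.Unique.Propositional using (Unique)
import Data.List.Relation.Unary.Unique.Propositional.Properties as Unique
open import Data.Nat.Base using (ℕ; zero; suc; _+_; _*_; _∸_; _≤_; _<_; _≥_; _⊔_; s≤s; z≤n; >-nonZero)
open import Data.Nat.Divisibility using (_∣_; divides; ∣⇒≤)
open import Data.Nat.Properties
import Data.Nat.Tactic.RingSolver as ℕ-Ring
open import Data.Product.Base using (_×_; _,_; proj₁; ∃)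
open import Function.Base using (_∘_)
open import Function.Bundles using (_⇔_; mk⇔; Equivalence)
open import Function.Definitions using (Injective)
open import Level using (0ℓ)
open import Relation.Binary.PropositionalEquality
open import Relation.Nullary.Decidable using (yes; no)
open import Relation.Nullary.Negation using (¬_; contradiction)
open import Relation.Unary using (Pred)

-- Counting through a parametrisation

preimages : {W A : Set} {g : W → A} {xs : List A} →
            (∀ {x} → x ∈ xs → ∃ λ w → g w ≡ x) → ∃ λ ws → map g ws ≡ xs
preimages {xs = []}     surj = [] , refl
preimages {xs = x ∷ xs} surj with surj (here refl) | preimages {xs = xs} (surj ∘ there)
... | w , refl | ws , refl = w ∷ ws , refl

-- Moves the count from partitions to words. Choosing one preimage per listed element gives a list
-- that `g` maps exactly onto the old one, so length and uniqueness carry over; injectivity of `g`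
-- makes it complete.
pullback : {W A : Set} {P : Pred A 0ℓ} {g : W → A} → Injective _≡_ _≡_ g →
           (∀ {x} → P x → ∃ λ w → g w ≡ x) → (e : Enumeration P) →
           ∃ λ (e′ : Enumeration (P ∘ g)) → count e′ ≡ count e
pullback {P = P} {g} inj surj e with preimages (surj ∘ Enumeration.sound e)
... | ws , eq = record
  { elements = ws
  ; unique   = Unique.map⁻ (subst Unique (sym eq) unique)
  ; sound    = λ w∈ → sound (subst (_ ∈_) eq (∈-map⁺ g w∈))
  ; complete = λ Pgw → w∈ws (∈-map⁻ g (subst (_ ∈_) (sym eq) (complete Pgw)))
  } , trans (sym (length-map g ws)) (cong length eq)
  where
  open Enumeration e
  w∈ws : ∀ {w} → (∃ λ v → v ∈ ws × g w ≡ g v) → w ∈ ws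
  w∈ws (v , v∈ , gw≡gv) = subst (_∈ ws) (sym (inj gw≡gv)) v∈

-- Duplicate-free lists with the same members are equal as bags, hence permutations of each other.
count-⇔ : {W : Set} {P Q : Pred W 0ℓ} (e : Enumeration P) (e′ : Enumeration Q) →
          (∀ w → P w ⇔ Q w) → count e ≡ count e′
count-⇔ e e′ P⇔Q = ↭-length (∼bag⇒↭ (unique∧set⇒bag E.unique E′.unique λ {w} →
  mk⇔ (E′.complete ∘ Equivalence.to (P⇔Q w) ∘ E.sound)
      (E.complete ∘ Equivalence.from (P⇔Q w) ∘ E′.sound)))
  where
  module E = Enumeration e
  module E′ = Enumeration e′

-- Words of moves: true increases the largest part by p, false prepends a new
-- largest part exceeding the old one by q.

move : (p q : ℕ) → Bool → List⁺ ℕ → List⁺ ℕ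
move p q true  (x ∷ xs) = (x + p) ∷ xs
move p q false (x ∷ xs) = (x + q) ∷ x ∷ xs

build : (a p q : ℕ) → List Bool → List⁺ ℕ
build a p q []      = a ∷ []
build a p q (b ∷ w) = move p q b (build a p q w)

bumps news : List Bool → ℕ
bumps []          = 0
bumps (true ∷ w)  = suc (bumps w)
bumps (false ∷ w) = bumps w
news []          = 0
news (true ∷ w)  = news w
news (false ∷ w) = suc (news w)

bumps-map-not : ∀ w → bumps (map not w) ≡ news w
bumps-map-not []          = refl
bumps-map-not (true ∷ w)  = bumps-map-not w
bumps-map-not (false ∷ w) = cong suc (bumps-map-not w)

news-map-not : ∀ w → news (map not w) ≡ bumps w
news-map-not []          = refl
news-map-not (true ∷ w)  = cong suc (news-map-not w)
news-map-not (false ∷ w) = news-map-not w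

map-not-involutive : ∀ w → map not (map not w) ≡ w
map-not-involutive w =
  trans (sym (map-∘ w)) (trans (map-cong not-involutive w) (map-id w))

-- Spaced lists: the image of `build`, and its injectivity

module _ (a p q : ℕ) where

  -- Describes the values of `build` without mentioning words: each witness `k` is the number of
  -- bumps made while that part was the largest. The pair `p`, `q` will be 1, `d` on the h-side and
  -- `suc d`, 0 on the f-side.
  Spaced : ℕ → List ℕ → Set
  Spaced x []       = ∃ λ k → x ≡ a + k * p
  Spaced x (y ∷ ys) = (∃ λ k → x ≡ y + q + k * p) × Spaced y ys

  Spaced⁺ : List⁺ ℕ → Set
  Spaced⁺ (x ∷ xs) = Spaced x xs

  bump-spaced : ∀ x xs → Spaced x xs → Spaced (x + p) xs
  bump-spaced x []       (k , refl)      = suc k , identity a k p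
    where
    identity : ∀ a k p → a + k * p + p ≡ a + suc k * p
    identity = ℕ-Ring.solve-∀
  bump-spaced x (y ∷ ys) ((k , refl) , s) = (suc k , identity y q k p) , s
    where
    identity : ∀ y q k p → y + q + k * p + p ≡ y + q + suc k * p
    identity = ℕ-Ring.solve-∀

  build-spaced : ∀ w → Spaced⁺ (build a p q w)
  build-spaced []          = 0 , sym (+-identityʳ a)
  build-spaced (true ∷ w)  = bump-spaced _ _ (build-spaced w)
  build-spaced (false ∷ w) = (0 , sym (+-identityʳ _)) , build-spaced w

  build-bumps : ∀ k w {x xs} → build a p q w ≡ x ∷ xs →
                build a p q (replicate k true ++ w) ≡ (x + k * p) ∷ xs
  build-bumps zero    w {x} {xs} eq = trans eq (cong (_∷ xs) (sym (+-identityʳ x)))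
  build-bumps (suc k) w {x} {xs} eq =
    trans (cong (move p q true) (build-bumps k w eq)) (cong (_∷ xs) (identity x k p))
    where
    identity : ∀ x k p → x + k * p + p ≡ x + suc k * p
    identity = ℕ-Ring.solve-∀

  build-surjective : ∀ x xs → Spaced x xs → ∃ λ w → build a p q w ≡ x ∷ xs
  build-surjective x []       (k , refl) = replicate k true ++ [] , build-bumps k [] refl
  build-surjective x (y ∷ ys) ((k , refl) , s) with build-surjective y ys s
  -- The head of a word is its last move: build the smaller parts, prepend `y + q`, then bump it `k`
  -- times.
  ... | w , eq = replicate k true ++ false ∷ w ,
                 build-bumps k (false ∷ w) (cong (move p q false) eq)

  spaced-linked : ∀ x xs → Spaced x xs → Linked (λ x y → y + q ≤ x) (x ∷ xs)
  spaced-linked x []       _                = [-]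
  spaced-linked x (y ∷ ys) ((k , refl) , s) = m≤m+n (y + q) (k * p) ∷ spaced-linked y ys s

  spaced-a≤ : ∀ x xs → Spaced x xs → All (a ≤_) (x ∷ xs)
  spaced-a≤ x []       (k , refl) = m≤m+n a (k * p) ∷ []
  spaced-a≤ x (y ∷ ys) ((k , refl) , s) with spaced-a≤ y ys s
  ... | a≤y ∷ a≤ys =
    ≤-trans a≤y (≤-trans (m≤m+n y q) (m≤m+n (y + q) (k * p))) ∷ a≤y ∷ a≤ys

  spaced-partition : 1 ≤ a → ∀ x xs → Spaced x xs → IsPartition (x ∷ xs)
  spaced-partition 1≤a x xs s =
    Linked.map (≤-trans (m≤m+n _ q)) (spaced-linked x xs s) ,
    All.map (≤-trans 1≤a) (spaced-a≤ x xs s)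

  length-build : ∀ w → #parts (build a p q w) ≡ suc (news w)
  length-build []          = refl
  length-build (true ∷ w)  = length-build w
  length-build (false ∷ w) = cong suc (length-build w)

  head-build : ∀ w → List⁺.head (build a p q w) ≡ a + bumps w * p + news w * q
  head-build []          = sym (trans (+-identityʳ _) (+-identityʳ a))
  head-build (true ∷ w)  =
    trans (cong (_+ p) (head-build w)) (identity a (bumps w) p (news w * q))
    where
    identity : ∀ a b p c → a + b * p + c + p ≡ a + suc b * p + c
    identity = ℕ-Ring.solve-∀
  head-build (false ∷ w) =
    trans (cong (_+ q) (head-build w)) (identity (a + bumps w * p) (news w) q)
    where
    identity : ∀ a c q → a + c * q + q ≡ a + suc c * q
    identity = ℕ-Ring.solve-∀

  module _ (1≤p : 1 ≤ p) where

    bump≢start : ∀ π → Spaced⁺ π → ¬ move p q true π ≡ a ∷ []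
    bump≢start (x ∷ []) (k , refl) eq =
      <-irrefl (sym (cong List⁺.head eq))
        (≤-<-trans (m≤m+n a (k * p)) (m<m+n (a + k * p) 1≤p))

    -- The gap between the first two parts tells the moves apart: it is exactly `q` after a prepend,
    -- but more than `q` after a bump, since it was at least `q` before and `p` is positive.
    bump≢new : ∀ π ρ → Spaced⁺ π → ¬ move p q true π ≡ move p q false ρ
    bump≢new (x ∷ y ∷ ys) (_ ∷ _) ((k , refl) , _) eq with cong List⁺.tail eq
    ... | refl = <-irrefl (sym (cong List⁺.head eq))
                   (≤-<-trans (m≤m+n (y + q) (k * p)) (m<m+n (y + q + k * p) 1≤p))

    move-injective : ∀ b {π ρ} → move p q b π ≡ move p q b ρ → π ≡ ρ
    move-injective true  {x ∷ xs} {y ∷ ys} eq =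
      cong₂ _∷_ (+-cancelʳ-≡ p x y (cong List⁺.head eq)) (cong List⁺.tail eq)
    move-injective false {x ∷ xs} {y ∷ ys} eq with cong List⁺.tail eq
    ... | refl = refl

    -- The last move can be read off the result and then undone, so the word is recovered from its
    -- head onwards.
    build-injective : Injective _≡_ _≡_ (build a p q)
    build-injective {[]}        {[]}        _  = refl
    build-injective {[]}        {true ∷ w}  eq = contradiction (sym eq) (bump≢start _ (build-spaced w))
    build-injective {[]}        {false ∷ w} eq with () ← cong List⁺.tail eq
    build-injective {true ∷ v}  {[]}        eq = contradiction eq (bump≢start _ (build-spaced v))
    build-injective {false ∷ v} {[]}        eq with () ← cong List⁺.tail eq
    build-injective {true ∷ v}  {true ∷ w}  eq = cong (true ∷_) (build-injective (move-injective true eq))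
    build-injective {false ∷ v} {false ∷ w} eq = cong (false ∷_) (build-injective (move-injective false eq))
    build-injective {true ∷ v}  {false ∷ w} eq =
      contradiction eq (bump≢new _ (build a p q w) (build-spaced v))
    build-injective {false ∷ v} {true ∷ w}  eq =
      contradiction (sym eq) (bump≢new _ (build a p q v) (build-spaced w))

-- Both families of partitions as spaced lists

largest≡head : ∀ x xs → Linked _≥_ (x ∷ xs) → largest (x ∷ xs) ≡ x
largest≡head x []       _         = refl
largest≡head x (y ∷ ys) (y≤x ∷ l) =
  trans (cong (x ⊔_) (largest≡head y ys l)) (m≥n⇒m⊔n≡m y≤x)

largest-build : ∀ a p q → 1 ≤ a → ∀ w →
                largest (build a p q w) ≡ a + bumps w * p + news w * q
largest-build a p q 1≤a w =
  trans (largest≡head _ _ (proj₁ (spaced-partition a p q 1≤a _ _ (build-spaced a p q w))))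
        (head-build a p q w)

-- For `p = 1` the multiple of `p` is any natural number, so the witnesses are the slacks of the
-- inequalities.
h⇒spaced : ∀ {d a} x xs → Linked (λ x y → y + d ≤ x) (x ∷ xs) → All (a ≤_) (x ∷ xs) →
           Spaced a 1 d x xs
h⇒spaced {a = a} x [] _ (a≤x ∷ _) with m≤n⇒∃[o]m+o≡n a≤x
... | k , refl = k , cong (_+_ a) (sym (*-identityʳ k))
h⇒spaced {d} x (y ∷ ys) (y+d≤x ∷ l) (_ ∷ a≤ys) with m≤n⇒∃[o]m+o≡n y+d≤x
... | k , refl = (k , cong (_+_ (y + d)) (sym (*-identityʳ k))) , h⇒spaced y ys l a≤ys

spaced⇒h : ∀ {d a} → 1 ≤ a → ∀ π → Spaced⁺ a 1 d π → HPartition d a π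
spaced⇒h {d} {a} 1≤a (x ∷ xs) s =
  spaced-partition a 1 d 1≤a x xs s , spaced-linked a 1 d x xs s , spaced-a≤ a 1 d x xs s

∣m-n∣≡m∸n : ∀ {m n} → n ≤ m → ∣ + m ℤ.- + n ∣ ≡ m ∸ n
∣m-n∣≡m∸n {m} {n} n≤m = cong ∣_∣ (trans (ℤ.m-n≡m⊖n m n) (ℤ.⊖-≥ n≤m))

∣m-n∣≡n∸m : ∀ {m n} → m ≤ n → ∣ + m ℤ.- + n ∣ ≡ n ∸ m
∣m-n∣≡n∸m {m} {n} m≤n = trans (cong ∣_∣ (ℤ.m-n≡m⊖n m n)) (ℤ.∣⊖∣-≤ m≤n)

≡mod⇒∃ : ∀ {x a m} → 1 ≤ x → a ≤ m → x ≡ a [mod m ] → ∃ λ k → x ≡ a + k * m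
≡mod⇒∃ {x} {a} {m} 1≤x a≤m m∣ with a ≤? x
... | yes a≤x with subst (m ∣_) (∣m-n∣≡m∸n a≤x) m∣
...   | divides k eq = k , trans (sym (m+[n∸m]≡n a≤x)) (cong (_+_ a) eq)
-- If `x < a`, then `m` divides the positive number `a ∸ x`, which is below `a` because `x` is
-- positive; this gives `m < a`.
≡mod⇒∃ {x} {a} {m} 1≤x a≤m m∣ | no a≰x = contradiction a≤m (<⇒≱ (begin-strict
  m          ≤⟨ ∣⇒≤ {{>-nonZero (m<n⇒0<n∸m x<a)}} (subst (m ∣_) (∣m-n∣≡n∸m (<⇒≤ x<a)) m∣) ⟩
  a ∸ x      <⟨ ∸-monoʳ-< 1≤x (<⇒≤ x<a) ⟩
  a          ∎))
  where
  open ≤-Reasoning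
  x<a : x < a
  x<a = ≰⇒> a≰x

∃⇒≡mod : ∀ a k m → (a + k * m) ≡ a [mod m ]
∃⇒≡mod a k m = divides k (trans (∣m-n∣≡m∸n (m≤m+n a (k * m))) (m+n∸m≡n a (k * m)))

f⇒spaced : ∀ {d a} → a ≤ suc d → ∀ x xs → Linked _≥_ (x ∷ xs) → All (1 ≤_) (x ∷ xs) →
           All (_≡ a [mod suc d ]) (x ∷ xs) → Spaced a (suc d) 0 x xs
f⇒spaced a≤m x [] _ (1≤x ∷ _) (x≡a ∷ _) = ≡mod⇒∃ 1≤x a≤m x≡a
f⇒spaced {d} {a} a≤m x (y ∷ ys) (y≤x ∷ l) (1≤x ∷ 1≤ys@(1≤y ∷ _)) (x≡a ∷ ys≡a@(y≡a ∷ _))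
  with ≡mod⇒∃ 1≤x a≤m x≡a | ≡mod⇒∃ 1≤y a≤m y≡a
... | k , refl | j , refl
  -- With `x = a + k * suc d` and `y = a + j * suc d`, the order `y ≤ x` gives `j ≤ k`; the
  -- difference `i` is the witness for the gap.
  with m≤n⇒∃[o]m+o≡n (*-cancelʳ-≤ j k (suc d) (+-cancelˡ-≤ a _ _ y≤x))
... | i , refl = (i , identity a j i (suc d)) , f⇒spaced a≤m y ys l 1≤ys ys≡a
  where
  identity : ∀ a j i m → a + (j + i) * m ≡ a + j * m + 0 + i * m
  identity = ℕ-Ring.solve-∀

-- With `q = 0` every gap is a multiple of `p`, so the coefficients add up from the smallest part.
spaced-∃ : ∀ {a p} x xs → Spaced a p 0 x xs → All (λ x → ∃ λ k → x ≡ a + k * p) (x ∷ xs)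
spaced-∃         x []       s                = s ∷ []
spaced-∃ {a} {p} x (y ∷ ys) ((k , refl) , s) with spaced-∃ y ys s
... | (j , refl) ∷ rest = (j + k , identity a j k p) ∷ (j , refl) ∷ rest
  where
  identity : ∀ a j i m → a + j * m + 0 + i * m ≡ a + (j + i) * m
  identity = ℕ-Ring.solve-∀

spaced⇒f : ∀ {d a} → 1 ≤ a → ∀ π → Spaced⁺ a (suc d) 0 π → FPartition d a π
spaced⇒f {d} {a} 1≤a (x ∷ xs) s =
  spaced-partition a (suc d) 0 1≤a x xs s ,
  All.map (λ { (k , refl) → ∃⇒≡mod a k (suc d) }) (spaced-∃ x xs s)

-- The bijection and the statistics it carries

module _ {d a : ℕ} (1≤a : 1 ≤ a) (a≤1+d : a ≤ suc d) where

  -- The exchange of moves is `map not`: the letter `true` raises the largest part by 1 in `toH` and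
  -- duplicates it in `toF`, so one word indexes a pair of corresponding partitions.
  toH toF : List Bool → List⁺ ℕ
  toH = build a 1 d
  toF = build a (suc d) 0 ∘ map not

  toH-H : ∀ w → HPartition d a (toH w)
  toH-H w = spaced⇒h 1≤a _ (build-spaced a 1 d w)

  toF-F : ∀ w → FPartition d a (toF w)
  toF-F w = spaced⇒f 1≤a _ (build-spaced a (suc d) 0 (map not w))

  toH-injective : Injective _≡_ _≡_ toH
  toH-injective = build-injective a 1 d ≤-refl

  toF-injective : Injective _≡_ _≡_ toF
  toF-injective = map-injective not-injective ∘ build-injective a (suc d) 0 (s≤s z≤n)

  toH-surjective : ∀ {π} → HPartition d a π → ∃ λ w → toH w ≡ π
  toH-surjective {x ∷ xs} (_ , l , a≤) = build-surjective a 1 d x xs (h⇒spaced x xs l a≤)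

  toF-surjective : ∀ {π} → FPartition d a π → ∃ λ w → toF w ≡ π
  toF-surjective {x ∷ xs} ((l , 1≤) , ≡a)
    with build-surjective a (suc d) 0 x xs (f⇒spaced a≤1+d x xs l 1≤ ≡a)
  ... | w , eq = map not w , trans (cong (build a (suc d) 0) (map-not-involutive w)) eq

  -- All three equalities of the theorem go through this: both counts become counts of words,
  -- leaving a comparison of conditions on a single word.
  count-transfer : {P Q : Pred (List⁺ ℕ) 0ℓ} →
    (∀ {π} → P π → HPartition d a π) → (∀ {π} → Q π → FPartition d a π) →
    (e : Enumeration P) (e′ : Enumeration Q) →
    (∀ w → P (toH w) ⇔ Q (toF w)) → count e ≡ count e′
  count-transfer P⇒H Q⇒F e e′ P⇔Q
    with pullback toH-injective (toH-surjective ∘ P⇒H) e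
       | pullback toF-injective (toF-surjective ∘ Q⇒F) e′
  ... | E , E≡e | E′ , E′≡e′ = trans (sym E≡e) (trans (count-⇔ E E′ P⇔Q) E′≡e′)

  largest-toH : ∀ w → largest (toH w) ≡ a + bumps w + news w * d
  largest-toH w = trans (largest-build a 1 d 1≤a w)
    (cong (λ b → a + b + news w * d) (*-identityʳ (bumps w)))

  #parts-toH : ∀ w → #parts (toH w) ≡ suc (news w)
  #parts-toH = length-build a 1 d

  largest-toF : ∀ w → largest (toF w) ≡ a + suc d * news w
  largest-toF w rewrite largest-build a (suc d) 0 1≤a (map not w)
    | bumps-map-not w | news-map-not w = identity a (news w) (suc d) (bumps w)
    where
    identity : ∀ a n m b → a + n * m + b * 0 ≡ a + m * n
    identity = ℕ-Ring.solve-∀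

  #parts-toF : ∀ w → #parts (toF w) ≡ suc (bumps w)
  #parts-toF w = trans (length-build a (suc d) 0 (map not w)) (cong suc (news-map-not w))

  -- Both sides are `a + bumps w + suc d * news w`.
  perimeter-toH≡toF : ∀ w → perimeter (toH w) ≡ perimeter (toF w)
  perimeter-toH≡toF w rewrite largest-toH w | #parts-toH w | largest-toF w | #parts-toF w =
    cong (_∸ 1) (identity a (bumps w) (news w) d)
    where
    identity : ∀ a b n d → a + b + n * d + suc n ≡ a + suc d * n + suc b
    identity = ℕ-Ring.solve-∀

  -- Each side says `news w ≡ ℓ`; on the right this uses that `suc d` is nonzero.
  #parts-toH⇔largest-toF : ∀ w ℓ →
    #parts (toH w) ≡ suc ℓ ⇔ largest (toF w) ≡ a + suc d * ℓ
  #parts-toH⇔largest-toF w ℓ rewrite #parts-toH w | largest-toF w =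
    mk⇔ (cong (λ n → a + suc d * n) ∘ suc-injective)
        (cong suc ∘ *-cancelˡ-≡ _ _ (suc d) ∘ +-cancelˡ-≡ a _ _)

  -- The two conditions are not equivalent componentwise: either #parts (toH w)
  -- or largest (toF w) first pins news w to ℓ, which links the other two.
  shape⇔ : ∀ w α ℓ →
    (+ largest (toH w) ≡ + α × + #parts (toH w) ≡ + suc ℓ) ⇔
    (+ largest (toF w) ≡ + a ℤ.+ + suc d ℤ.* (+ suc ℓ ℤ.- + 1) ×
     + #parts (toF w) ≡ + α ℤ.- + a ℤ.- + d ℤ.* (+ suc ℓ ℤ.- + 1) ℤ.+ + 1)
  shape⇔ w α ℓ = mk⇔
    (λ { (eα , eℓ) → let eL = Equivalence.to iff (ℤ.+-injective eℓ) in
         trans (cong +_ eL) (sym castL) ,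
         partsF (suc-injective (trans (sym (#parts-toH w)) (ℤ.+-injective eℓ))) eα })
    (λ { (eL , eP) → let e = Equivalence.from iff (ℤ.+-injective (trans eL castL)) in
         largestH (suc-injective (trans (sym (#parts-toH w)) e)) eP , cong +_ e })
    where
    iff : #parts (toH w) ≡ suc ℓ ⇔ largest (toF w) ≡ a + suc d * ℓ
    iff = #parts-toH⇔largest-toF w ℓ

    -- `+ suc ℓ ℤ.- + 1` computes to `+ ℓ`, so only the product has to be cast.
    castL : + a ℤ.+ + suc d ℤ.* (+ suc ℓ ℤ.- + 1) ≡ + (a + suc d * ℓ)
    castL = cong (ℤ._+_ (+ a)) (sym (ℤ.pos-* (suc d) ℓ))

    cast-largest : + (a + bumps w + ℓ * d) ≡ + a ℤ.+ + bumps w ℤ.+ + ℓ ℤ.* + d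
    cast-largest = cong (ℤ._+_ (+ (a + bumps w))) (ℤ.pos-* ℓ d)

    partsF : news w ≡ ℓ → + largest (toH w) ≡ + α →
             + #parts (toF w) ≡ + α ℤ.- + a ℤ.- + d ℤ.* + ℓ ℤ.+ + 1
    partsF refl eα rewrite sym eα | #parts-toF w | largest-toH w | cast-largest =
      identity (+ a) (+ bumps w) (+ ℓ) (+ d)
      where
      identity : ∀ a b n d → + 1 ℤ.+ b ≡ a ℤ.+ b ℤ.+ n ℤ.* d ℤ.- a ℤ.- d ℤ.* n ℤ.+ + 1
      identity = ℤ-Ring.solve-∀

    largestH : news w ≡ ℓ → + #parts (toF w) ≡ + α ℤ.- + a ℤ.- + d ℤ.* + ℓ ℤ.+ + 1 →
               + largest (toH w) ≡ + α
    largestH refl eP rewrite #parts-toF w | largest-toH w = begin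
      + (a + bumps w + news w * d)
        ≡⟨ cast-largest ⟩
      + a ℤ.+ + bumps w ℤ.+ + ℓ ℤ.* + d
        -- Isolates `+ suc (bumps w)`, the left side of `eP`; after the replacement the bracket
        -- cancels everything but `+ α`.
        ≡⟨ identity₁ (+ a) (+ bumps w) (+ ℓ) (+ d) ⟩
      + suc (bumps w) ℤ.+ (+ a ℤ.+ + d ℤ.* + ℓ ℤ.- + 1)
        ≡⟨ cong (ℤ._+ _) eP ⟩
      + α ℤ.- + a ℤ.- + d ℤ.* + ℓ ℤ.+ + 1 ℤ.+ (+ a ℤ.+ + d ℤ.* + ℓ ℤ.- + 1)
        ≡⟨ identity₂ (+ α) (+ a) (+ ℓ) (+ d) ⟩
      + α ∎
      where
      open ≡-Reasoning
      identity₁ : ∀ a b n d →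
        a ℤ.+ b ℤ.+ n ℤ.* d ≡ + 1 ℤ.+ b ℤ.+ (a ℤ.+ d ℤ.* n ℤ.- + 1)
      identity₁ = ℤ-Ring.solve-∀
      identity₂ : ∀ α a n d →
        α ℤ.- a ℤ.- d ℤ.* n ℤ.+ + 1 ℤ.+ (a ℤ.+ d ℤ.* n ℤ.- + 1) ≡ α
      identity₂ = ℤ-Ring.solve-∀

theorem1p4 : (d n a : ℕ) → 1 ≤ d → 1 ≤ n → 1 ≤ a → a ≤ suc d →
    (h d a n ≡ f d a n)
    × ((ℓ : ℕ) → 1 ≤ ℓ →
    count (hPartitionsWithParts d a n ℓ)
    ≡ count (fPartitionsWithLargest d a n (a + suc d * (ℓ ∸ 1))))
    × ((α ℓ : ℕ) → 1 ≤ α → 1 ≤ ℓ → n ≡ α + ℓ ∸ 1 →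
    h-shape d a (+ α) (+ ℓ)
    ≡ f-shape d a
    (+ a ℤ.+ + suc d ℤ.* (+ ℓ ℤ.- + 1))
    (+ α ℤ.- + a ℤ.- + d ℤ.* (+ ℓ ℤ.- + 1) ℤ.+ + 1))
theorem1p4 d n a _ _ 1≤a a≤1+d =
  count-transfer 1≤a a≤1+d proj₁ proj₁ (hPartitions d a n) (fPartitions d a n) perimeter⇔ ,
  (λ { (suc ℓ) _ → count-transfer 1≤a a≤1+d (proj₁ ∘ proj₁) (proj₁ ∘ proj₁)
       (hPartitionsWithParts d a n (suc ℓ)) (fPartitionsWithLargest d a n _) λ w →
       let open Equivalence (perimeter⇔ w)
           module L = Equivalence (#parts-toH⇔largest-toF 1≤a a≤1+d w ℓ)
       in mk⇔ (λ (H , e) → to H , L.to e) (λ (F , e) → from F , L.from e) }) ,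
  (λ { α (suc ℓ) _ _ _ → count-transfer 1≤a a≤1+d proj₁ proj₁
       (hPartitionsOfShape d a (+ α) (+ suc ℓ)) (fPartitionsOfShape d a _ _) λ w →
       let open Equivalence (shape⇔ 1≤a a≤1+d w α ℓ)
       in mk⇔ (λ (_ , s) → toF-F 1≤a a≤1+d w , to s)
              (λ (_ , s) → toH-H 1≤a a≤1+d w , from s) })
  where
  -- Every word builds members of both families, so only the perimeter equation has to be carried
  -- across.
  perimeter⇔ : ∀ w →
    (HPartition d a (toH 1≤a a≤1+d w) × perimeter (toH 1≤a a≤1+d w) ≡ n) ⇔
    (FPartition d a (toF 1≤a a≤1+d w) × perimeter (toF 1≤a a≤1+d w) ≡ n)
  perimeter⇔ w = mk⇔
    (λ (_ , e) → toF-F 1≤a a≤1+d w , trans (sym (perimeter-toH≡toF 1≤a a≤1+d w)) e)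
    (λ (_ , e) → toH-H 1≤a a≤1+d w , trans (perimeter-toH≡toF 1≤a a≤1+d w) e)
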